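{- Let $M$ be a finite set, let $(\lambda,\mathcal{L})$ be a ranked lattice of subsets of $M$ and let $\mu$ be a measure on $M$. Let $r(A)=\min\{\lambda(Z)+\mu(A\setminus Z): Z\in\mathcal{L}\}$ for $A\subseteq M$. Suppose that for all $Z_1,Z_2\in\mathcal{L}$ $$\lambda(Z_1)+\lambda(Z_2)\ge \lambda(Z_1\lor Z_2)+\lambda(Z_1\land Z_2)+\mu\big((Z_1\cap Z_2)\setminus(Z_1\land Z_2)\big).$$ Then $(r,M)$ is a polymatroid.
   Context: A polymatroid $(f,M)$ is a non-negative, monotone, submodular real function $f$ on the subsets of the finite set $M$ (the condition $f(\emptyset)=0$ is not part of this definition). A measure on $M$ is a non-negative additive function $\mu$ on the subsets of $M$, i.e. $\mu(A)=\sum_{a\in A}\mu(\{a\})$ with $\mu(\{a\})\ge 0$. A lattice $\mathcal{L}$ of subsets of $M$ is a non-empty collection of subsets of $M$ which is a lattice under the inclusion order: any $Z_1,Z_2\in\mathcal{L}$ have in $\mathcal{L}$ a least upper bound $Z_1\lor Z_2$ and a greatest lower bound $Z_1\land Z_2$ (these need not be the union and the intersection). A ranked lattice $(\lambda,\mathcal{L})$ is such a lattice with a function $\lambda:\mathcal{L}\to\mathbb{R}_{\ge0}$ (not assumed monotone). -}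

module Defs where

open import Data.Bool.Base using (Bool; T)
open import Data.Bool.Properties using (T?)
open import Data.Fin.Base using (Fin; zero; suc)
open import Data.Fin.Subset using (Subset; inside; outside; ⁅_⁆; _⊆_; _∪_; _∩_; _─_)
open import Data.List.Base using (List; []; _∷_; _++_; map; mapMaybe; foldr)
import Data.Maybe.Base as Maybe
open import Data.Nat.Base as ℕ using (ℕ)
import Data.Nat.Properties as ℕ
open import Data.Product.Base using (Σ; ∃; _×_; _,_; proj₁)
open import Data.Rational.Base as ℚ using (ℚ; 0ℚ; ½; ∣_∣)
import Data.Rational.Properties as ℚ
import Data.Rational.Solver as ℚ
open import Data.Sum.Base using (inj₁; inj₂)
open import Data.Vec.Base using ([]; _∷_)
open import Function.Base using (_∘_; _on_)
open import Relation.Binary.Core using (Rel)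
open import Relation.Binary.Lattice.Structures using (IsLattice)
open import Relation.Binary.PropositionalEquality
  using (_≡_; refl; sym; trans; cong; subst; subst₂)
open import Relation.Nullary.Decidable.Core using (dec⇒maybe)

open ℚ.+-*-Solver using (solve; _:+_; _:-_; :-_; _:=_)

IsCauchy : (ℕ → ℚ) → Set
IsCauchy x = ∀ ε → 0ℚ ℚ.< ε →
  ∃ λ N → ∀ m n → N ℕ.≤ m → N ℕ.≤ n → ∣ x m ℚ.- x n ∣ ℚ.< ε

∣-∣<⇒< : ∀ {p q ε} → ∣ p ℚ.- q ∣ ℚ.< ε → p ℚ.< q ℚ.+ ε
∣-∣<⇒< {p} {q} {ε} h =
  subst (ℚ._< q ℚ.+ ε) (cancel p q)
    (ℚ.+-monoʳ-< q (ℚ.≤-<-trans (r≤∣r∣ (p ℚ.- q)) h))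
  where
  cancel : ∀ p q → q ℚ.+ (p ℚ.- q) ≡ p
  cancel = solve 2 (λ p q → q :+ (p :- q) := p) refl
  r≤∣r∣ : ∀ r → r ℚ.≤ ∣ r ∣
  r≤∣r∣ r with ℚ.≤-total 0ℚ r
  ... | inj₁ 0≤r = ℚ.≤-reflexive (sym (ℚ.0≤p⇒∣p∣≡p 0≤r))
  ... | inj₂ r≤0 = ℚ.≤-trans r≤0 (ℚ.nonNegative⁻¹ ∣ r ∣ ⦃ ℚ.∣-∣-nonNeg r ⦄)

<⇒∣-∣< : ∀ {p q ε} → p ℚ.< q ℚ.+ ε → q ℚ.< p ℚ.+ ε → ∣ p ℚ.- q ∣ ℚ.< ε
<⇒∣-∣< {p} {q} {ε} p<q+ε q<p+ε with ℚ.∣p∣≡p∨∣p∣≡-p (p ℚ.- q)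
... | inj₁ eq = subst₂ ℚ._<_ (sym eq) (cancel q ε) (ℚ.+-monoˡ-< (ℚ.- q) p<q+ε)
  where
  cancel : ∀ q ε → (q ℚ.+ ε) ℚ.- q ≡ ε
  cancel = solve 2 (λ q ε → (q :+ ε) :- q := ε) refl
... | inj₂ eq = subst₂ ℚ._<_ (trans (flip p q) (sym eq)) (cancel p ε)
                  (ℚ.+-monoˡ-< (ℚ.- p) q<p+ε)
  where
  flip : ∀ p q → q ℚ.- p ≡ ℚ.- (p ℚ.- q)
  flip = solve 2 (λ p q → q :- p := :- (p :- q)) refl
  cancel : ∀ p ε → (p ℚ.+ ε) ℚ.- p ≡ ε
  cancel = solve 2 (λ p ε → (p :+ ε) :- p := ε) refl

0<ε*½ : ∀ {ε} → 0ℚ ℚ.< ε → 0ℚ ℚ.< ε ℚ.* ½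
0<ε*½ 0<ε = ℚ.*-monoˡ-<-pos ½ 0<ε

ε*½+ε*½ : ∀ ε → ε ℚ.* ½ ℚ.+ ε ℚ.* ½ ≡ ε
ε*½+ε*½ ε = trans (sym (ℚ.*-distribˡ-+ ε ½ ½)) (ℚ.*-identityʳ ε)

+-isCauchy : ∀ {x y} → IsCauchy x → IsCauchy y → IsCauchy (λ n → x n ℚ.+ y n)
+-isCauchy {x} {y} cx cy ε 0<ε with cx (ε ℚ.* ½) (0<ε*½ 0<ε) | cy (ε ℚ.* ½) (0<ε*½ 0<ε)
... | N , hx | K , hy = N ℕ.⊔ K , λ m n m≥ n≥ →
  ℚ.≤-<-trans
    (subst (ℚ._≤ ∣ x m ℚ.- x n ∣ ℚ.+ ∣ y m ℚ.- y n ∣)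
      (cong ∣_∣ (rearrange (x m) (x n) (y m) (y n)))
      (ℚ.∣p+q∣≤∣p∣+∣q∣ (x m ℚ.- x n) (y m ℚ.- y n)))
    (subst (∣ x m ℚ.- x n ∣ ℚ.+ ∣ y m ℚ.- y n ∣ ℚ.<_) (ε*½+ε*½ ε)
      (ℚ.+-mono-<
        (hx m n (ℕ.m⊔n≤o⇒m≤o N K m≥) (ℕ.m⊔n≤o⇒m≤o N K n≥))
        (hy m n (ℕ.m⊔n≤o⇒n≤o N K m≥) (ℕ.m⊔n≤o⇒n≤o N K n≥))))
  where
  rearrange : ∀ a b c d → (a ℚ.- b) ℚ.+ (c ℚ.- d) ≡ (a ℚ.+ c) ℚ.- (b ℚ.+ d)
  rearrange = solve 4 (λ a b c d → (a :- b) :+ (c :- d) := (a :+ c) :- (b :+ d)) refl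

⊓-isCauchy : ∀ {x y} → IsCauchy x → IsCauchy y → IsCauchy (λ n → x n ℚ.⊓ y n)
⊓-isCauchy {x} {y} cx cy ε 0<ε with cx ε 0<ε | cy ε 0<ε
... | N , hx | K , hy = N ℕ.⊔ K , λ m n m≥ n≥ →
  <⇒∣-∣< (bound m n m≥ n≥) (bound n m n≥ m≥)
  where
  bound : ∀ m n → N ℕ.⊔ K ℕ.≤ m → N ℕ.⊔ K ℕ.≤ n →
          x m ℚ.⊓ y m ℚ.< (x n ℚ.⊓ y n) ℚ.+ ε
  bound m n m≥ n≥ with ℚ.⊓-sel (x n) (y n)
  ... | inj₁ eq rewrite eq = ℚ.≤-<-trans (ℚ.p⊓q≤p (x m) (y m))
    (∣-∣<⇒< (hx m n (ℕ.m⊔n≤o⇒m≤o N K m≥) (ℕ.m⊔n≤o⇒m≤o N K n≥)))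
  ... | inj₂ eq rewrite eq = ℚ.≤-<-trans (ℚ.p⊓q≤q (x m) (y m))
    (∣-∣<⇒< (hy m n (ℕ.m⊔n≤o⇒n≤o N K m≥) (ℕ.m⊔n≤o⇒n≤o N K n≥)))

-- Reals as Cauchy sequences of rationals; no quotient is taken, and _≃_ below
-- plays the role of equality.
record ℝ : Set where
  constructor mkℝ
  field
    seq    : ℕ → ℚ
    cauchy : IsCauchy seq

open ℝ public

infix  4 _≤_ _≃_
infixl 6 _+_
infixl 7 _⊓_

0ℝ : ℝ
0ℝ = mkℝ (λ _ → 0ℚ) λ _ 0<ε → 0 , λ _ _ _ _ → 0<ε

_+_ : ℝ → ℝ → ℝ
x + y = mkℝ (λ n → seq x n ℚ.+ seq y n) (+-isCauchy {seq x} {seq y} (cauchy x) (cauchy y))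

_⊓_ : ℝ → ℝ → ℝ
x ⊓ y = mkℝ (λ n → seq x n ℚ.⊓ seq y n) (⊓-isCauchy {seq x} {seq y} (cauchy x) (cauchy y))

-- The slack ε cannot be dropped: the order has to be that of the limits.
_≤_ : ℝ → ℝ → Set
x ≤ y = ∀ ε → 0ℚ ℚ.< ε → ∃ λ N → ∀ n → N ℕ.≤ n → seq x n ℚ.≤ seq y n ℚ.+ ε

_≃_ : ℝ → ℝ → Set
x ≃ y = x ≤ y × y ≤ x

-- The ground set M is Fin n.

∑∈ : ∀ {n} → Subset n → (Fin n → ℝ) → ℝ
∑∈ []            w = 0ℝ
∑∈ (inside  ∷ A) w = w zero + ∑∈ A (w ∘ suc)
∑∈ (outside ∷ A) w = ∑∈ A (w ∘ suc)

record IsMeasure {n} (μ : Subset n → ℝ) : Set where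
  field
    nonNegative : ∀ a → 0ℝ ≤ μ ⁅ a ⁆
    additive    : ∀ A → μ A ≃ ∑∈ A (λ a → μ ⁅ a ⁆)

record IsPolymatroid {n} (f : Subset n → ℝ) : Set where
  field
    nonNegative : ∀ A → 0ℝ ≤ f A
    monotone    : ∀ A B → A ⊆ B → f A ≤ f B
    submodular  : ∀ A B → f (A ∪ B) + f (A ∩ B) ≤ f A + f B

-- A collection of subsets of a finite set, given by its characteristic function
-- (as Subset n itself is). T is proof-irrelevant, so _≡_ on Member C is equality
-- of the underlying subsets.
Collection : ℕ → Set
Collection n = Subset n → Bool

Member : ∀ {n} → Collection n → Set
Member {n} C = Σ (Subset n) (T ∘ C)

subsets : ∀ n → List (Subset n)
subsets ℕ.zero    = [] ∷ []
subsets (ℕ.suc n) = map (inside ∷_) (subsets n) ++ map (outside ∷_) (subsets n)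

members : ∀ {n} (C : Collection n) → List (Member C)
members {n} C = mapMaybe (λ Z → Maybe.map (Z ,_) (dec⇒maybe (T? (C Z)))) (subsets n)

record RankedLattice (n : ℕ) : Set where
  infixr 6 _∨_
  infixr 7 _∧_
  field
    ℒ         : Collection n
    nonEmpty  : Member ℒ
    _∨_ _∧_   : Member ℒ → Member ℒ → Member ℒ
    isLattice : IsLattice _≡_ (_⊆_ on proj₁) _∨_ _∧_
    rank      : Member ℒ → ℝ
    rank≥0    : ∀ Z → 0ℝ ≤ rank Z

-- r(A) = min { λ(Z) + μ(A ∖ Z) : Z ∈ ℒ }. The list enumerates all of ℒ; starting
-- the fold at the value of some member does not change the minimum and avoids
-- adjoining +∞.
convolution : ∀ {n} → RankedLattice n → (Subset n → ℝ) → Subset n → ℝ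
convolution L μ A = foldr (λ Z m → value Z ⊓ m) (value nonEmpty) (members ℒ)
  where
  open RankedLattice L
  value : Member ℒ → ℝ
  value Z = rank Z + μ (A ─ proj₁ Z)

{-# OPTIONS --safe #-}
-- A minimiser Z₁ for A and a minimiser Z₂ for B are combined into the candidates
-- Z₁ ∨ Z₂ for A ∪ B and Z₁ ∧ Z₂ for A ∩ B.  The measure terms compare because
-- μ is modular and monotone and Z₁ ∪ Z₂ ⊆ Z₁ ∨ Z₂; the correction term
-- μ ((Z₁ ∩ Z₂) ∖ (Z₁ ∧ Z₂)) pays for the elements that the meet misses.  Minimisers
-- cannot be computed over the reals, so the argument runs over all pairs (Z₁ , Z₂)
-- and uses that addition distributes over finite minima.
module Submission where

open import Defs
open import Data.Nat.Base using (ℕ)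
open import Data.Fin.Subset using (Subset; _∩_; _─_)
open import Data.Product.Base using (proj₁)

open import Data.Bool.Properties using (T?; T-irrelevant)
open import Data.Fin.Base using (Fin; zero; suc)
open import Data.Fin.Subset using (inside; outside; ⁅_⁆; _∈_; _∉_; _⊆_; _∪_)
open import Data.Fin.Subset.Properties
  using (_∈?_; drop-∷-⊆; x∈p∩q⁺; x∈p∩q⁻; x∈p∪q⁺; x∈p∪q⁻; x∈p∧x∉q⇒x∈p─q; p─q⊆p)
open import Data.List.Base using ([]; _∷_; foldr; map)
open import Data.List.Membership.Propositional using (lose) renaming (_∈_ to _∈ₗ_)
open import Data.List.Membership.Propositional.Properties using (∈-map⁺; ∈-++⁺ˡ; ∈-++⁺ʳ)
open import Data.List.Relation.Unary.Any using (here; there)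
import Data.List.Relation.Unary.Any.Properties as Any
import Data.Maybe.Base as Maybe
import Data.Maybe.Relation.Unary.Any as MAny
import Data.Nat.Base as ℕ
import Data.Nat.Properties as ℕ
open import Data.Product.Base using (_,_; proj₂)
open import Data.Rational.Base as ℚ using (ℚ; 0ℚ; ½)
import Data.Rational.Properties as ℚ
open import Data.Rational.Solver using (module +-*-Solver)
open import Data.Sum.Base as Sum using (inj₁; inj₂)
open import Data.Vec.Base using ([]; _∷_; here; there)
open import Function.Base using (_∘_)
open import Relation.Binary.Bundles using (Preorder)
open import Relation.Binary.Lattice.Structures using (IsLattice)
open import Relation.Binary.PropositionalEquality
  using (_≡_; refl; sym; trans; cong; subst; isEquivalence)
open import Relation.Nullary.Decidable using (yes; no; dec-yes-irr; dec⇒maybe)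

open +-*-Solver using (solve; _:+_; _:=_)

-- Order and addition of Cauchy reals.

seq-≤⇒≤ : ∀ x y → (∀ n → seq x n ℚ.≤ seq y n) → x ≤ y
seq-≤⇒≤ x y x≤y ε 0<ε = 0 , λ n _ → begin
  seq x n         ≤⟨ x≤y n ⟩
  seq y n         ≡⟨ ℚ.+-identityʳ (seq y n) ⟨
  seq y n ℚ.+ 0ℚ  ≤⟨ ℚ.+-monoʳ-≤ (seq y n) (ℚ.<⇒≤ 0<ε) ⟩
  seq y n ℚ.+ ε   ∎
  where open ℚ.≤-Reasoning

-- The operations on `ℝ` act termwise, so identities of rationals transfer to reals through this
-- lemma, one inequality at a time.
seq-≡⇒≤ : ∀ x y → (∀ n → seq x n ≡ seq y n) → x ≤ y
seq-≡⇒≤ x y x≡y = seq-≤⇒≤ x y (ℚ.≤-reflexive ∘ x≡y)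

≤-refl : ∀ x → x ≤ x
≤-refl x = seq-≡⇒≤ x x (λ _ → refl)

≤-trans : ∀ x y z → x ≤ y → y ≤ z → x ≤ z
≤-trans x y z x≤y y≤z ε 0<ε
  with x≤y (ε ℚ.* ½) (0<ε*½ 0<ε) | y≤z (ε ℚ.* ½) (0<ε*½ 0<ε)
... | N , hx | K , hy = N ℕ.⊔ K , λ n n≥ → begin
  seq x n                              ≤⟨ hx n (ℕ.m⊔n≤o⇒m≤o N K n≥) ⟩
  seq y n ℚ.+ ε ℚ.* ½                  ≤⟨ ℚ.+-monoˡ-≤ (ε ℚ.* ½) (hy n (ℕ.m⊔n≤o⇒n≤o N K n≥)) ⟩
  (seq z n ℚ.+ ε ℚ.* ½) ℚ.+ ε ℚ.* ½    ≡⟨ ℚ.+-assoc (seq z n) (ε ℚ.* ½) (ε ℚ.* ½) ⟩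
  seq z n ℚ.+ (ε ℚ.* ½ ℚ.+ ε ℚ.* ½)    ≡⟨ cong (seq z n ℚ.+_) (ε*½+ε*½ ε) ⟩
  seq z n ℚ.+ ε                        ∎
  where open ℚ.≤-Reasoning

+-interchange : ∀ p q r s → (p ℚ.+ q) ℚ.+ (r ℚ.+ s) ≡ (p ℚ.+ r) ℚ.+ (q ℚ.+ s)
+-interchange = solve 4 (λ p q r s → (p :+ q) :+ (r :+ s) := (p :+ r) :+ (q :+ s)) refl

+-mono-≤ : ∀ x y u v → x ≤ y → u ≤ v → x + u ≤ y + v
+-mono-≤ x y u v x≤y u≤v ε 0<ε
  with x≤y (ε ℚ.* ½) (0<ε*½ 0<ε) | u≤v (ε ℚ.* ½) (0<ε*½ 0<ε)
... | N , hx | K , hu = N ℕ.⊔ K , λ n n≥ → begin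
  seq x n ℚ.+ seq u n
    ≤⟨ ℚ.+-mono-≤ (hx n (ℕ.m⊔n≤o⇒m≤o N K n≥)) (hu n (ℕ.m⊔n≤o⇒n≤o N K n≥)) ⟩
  (seq y n ℚ.+ ε ℚ.* ½) ℚ.+ (seq v n ℚ.+ ε ℚ.* ½)
    ≡⟨ +-interchange (seq y n) (ε ℚ.* ½) (seq v n) (ε ℚ.* ½) ⟩
  (seq y n ℚ.+ seq v n) ℚ.+ (ε ℚ.* ½ ℚ.+ ε ℚ.* ½)
    ≡⟨ cong ((seq y n ℚ.+ seq v n) ℚ.+_) (ε*½+ε*½ ε) ⟩
  (seq y n ℚ.+ seq v n) ℚ.+ ε
    ∎
  where open ℚ.≤-Reasoning

-- Taking `_≡_` as the equality is enough, since the chains below consist of `_≤_` steps alone.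
≤-preorder : Preorder _ _ _
≤-preorder = record
  { Carrier    = ℝ
  ; _≈_        = _≡_
  ; _≲_        = _≤_
  ; isPreorder = record
    { isEquivalence = isEquivalence
    ; reflexive     = λ { {x} refl → ≤-refl x }
    ; trans         = λ {x} {y} {z} → ≤-trans x y z
    }
  }

open import Relation.Binary.Reasoning.Preorder ≤-preorder

+-monoˡ-≤ : ∀ x y u → x ≤ y → x + u ≤ y + u
+-monoˡ-≤ x y u x≤y = +-mono-≤ x y u u x≤y (≤-refl u)

+-monoʳ-≤ : ∀ u x y → x ≤ y → u + x ≤ u + y
+-monoʳ-≤ u x y = +-mono-≤ u u x y (≤-refl u)

+-identityˡ-≥ : ∀ x → x ≤ 0ℝ + x
+-identityˡ-≥ x = seq-≡⇒≤ x (0ℝ + x) λ n → sym (ℚ.+-identityˡ (seq x n))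

+-identityʳ-≥ : ∀ x → x ≤ x + 0ℝ
+-identityʳ-≥ x = seq-≡⇒≤ x (x + 0ℝ) λ n → sym (ℚ.+-identityʳ (seq x n))

+-comm-≤ : ∀ x y → x + y ≤ y + x
+-comm-≤ x y = seq-≡⇒≤ (x + y) (y + x) λ n → ℚ.+-comm (seq x n) (seq y n)

+-interchange-≤ : ∀ x y u v → (x + y) + (u + v) ≤ (x + u) + (y + v)
+-interchange-≤ x y u v = seq-≡⇒≤ ((x + y) + (u + v)) ((x + u) + (y + v)) λ n →
  +-interchange (seq x n) (seq y n) (seq u n) (seq v n)

+-nonNegative : ∀ x y → 0ℝ ≤ x → 0ℝ ≤ y → 0ℝ ≤ x + y
+-nonNegative x y = +-mono-≤ 0ℝ x 0ℝ y

-- Finite minima of reals.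

⊓-lowerˡ : ∀ x y → x ⊓ y ≤ x
⊓-lowerˡ x y = seq-≤⇒≤ (x ⊓ y) x λ n → ℚ.p⊓q≤p (seq x n) (seq y n)

⊓-lowerʳ : ∀ x y → x ⊓ y ≤ y
⊓-lowerʳ x y = seq-≤⇒≤ (x ⊓ y) y λ n → ℚ.p⊓q≤q (seq x n) (seq y n)

ℚ-+-distribʳ-⊓ : ∀ r p q → (p ℚ.⊓ q) ℚ.+ r ≡ (p ℚ.+ r) ℚ.⊓ (q ℚ.+ r)
ℚ-+-distribʳ-⊓ r = ℚ.mono-≤-distrib-⊓ (ℚ.+-monoˡ-≤ r)

⊓-greatest : ∀ x y z → z ≤ x → z ≤ y → z ≤ x ⊓ y
⊓-greatest x y z z≤x z≤y ε 0<ε with z≤x ε 0<ε | z≤y ε 0<ε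
... | N , hx | K , hy = N ℕ.⊔ K , λ n n≥ →
  -- The slack stands outside the minimum; moved inside, it leaves one bound per argument, each with
  -- the full `ε`.
  subst (seq z n ℚ.≤_) (sym (ℚ-+-distribʳ-⊓ ε (seq x n) (seq y n)))
    (ℚ.⊓-glb (hx n (ℕ.m⊔n≤o⇒m≤o N K n≥)) (hy n (ℕ.m⊔n≤o⇒n≤o N K n≥)))

+-distribʳ-⊓-≤ : ∀ c x y → (x + c) ⊓ (y + c) ≤ (x ⊓ y) + c
+-distribʳ-⊓-≤ c x y = seq-≡⇒≤ ((x + c) ⊓ (y + c)) ((x ⊓ y) + c) λ n →
  sym (ℚ-+-distribʳ-⊓ (seq c n) (seq x n) (seq y n))

-- Shows that the property `z ≤ x + c` of `x` is closed under `_⊓_`, so that it can be carried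
-- through a fold of minima.
⊓-greatest-+ : ∀ c x y z → z ≤ x + c → z ≤ y + c → z ≤ (x ⊓ y) + c
⊓-greatest-+ c x y z z≤x+c z≤y+c = begin
  z                  ≲⟨ ⊓-greatest (x + c) (y + c) z z≤x+c z≤y+c ⟩
  (x + c) ⊓ (y + c)  ≲⟨ +-distribʳ-⊓-≤ c x y ⟩
  (x ⊓ y) + c        ∎

foldr-⊓-lower : ∀ {A : Set} (v : A → ℝ) e {a xs} → a ∈ₗ xs →
                foldr (λ b m → v b ⊓ m) e xs ≤ v a
foldr-⊓-lower v e {xs = b ∷ xs} (here refl)  = ⊓-lowerˡ (v b) (foldr (λ b m → v b ⊓ m) e xs)
foldr-⊓-lower v e {a} {b ∷ xs} (there a∈xs) = begin
  v b ⊓ foldr (λ b m → v b ⊓ m) e xs  ≲⟨ ⊓-lowerʳ (v b) (foldr (λ b m → v b ⊓ m) e xs) ⟩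
  foldr (λ b m → v b ⊓ m) e xs        ≲⟨ foldr-⊓-lower v e a∈xs ⟩
  v a                                 ∎

-- Replaces the choice of a minimiser: a property closed under `_⊓_` passes from all the values to
-- their minimum, whichever value attains it.
foldr-⊓-elim : ∀ {A : Set} (P : ℝ → Set) (v : A → ℝ) {e} →
               (∀ x y → P x → P y → P (x ⊓ y)) → P e → (∀ a → P (v a)) →
               ∀ xs → P (foldr (λ b m → v b ⊓ m) e xs)
foldr-⊓-elim P v P-⊓ Pe Pv []       = Pe
foldr-⊓-elim P v P-⊓ Pe Pv (b ∷ xs) =
  P-⊓ (v b) (foldr (λ b m → v b ⊓ m) _ xs) (Pv b) (foldr-⊓-elim P v P-⊓ Pe Pv xs)

-- Completeness of the enumeration of a collection.

∈-subsets : ∀ {n} (A : Subset n) → A ∈ₗ subsets n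
∈-subsets []            = here refl
∈-subsets (inside  ∷ A) = ∈-++⁺ˡ (∈-map⁺ (inside ∷_) (∈-subsets A))
∈-subsets (outside ∷ A) = ∈-++⁺ʳ (map (inside ∷_) (subsets _)) (∈-map⁺ (outside ∷_) (∈-subsets A))

∈-members : ∀ {n} (C : Collection n) (Z : Member C) → Z ∈ₗ members C
∈-members {n} C Z@(A , A∈C) =
  Any.mapMaybe⁺ _ (subsets n) (Any.map⁺ (lose (∈-subsets A) found))
  where
  found : MAny.Any (Z ≡_) (Maybe.map (A ,_) (dec⇒maybe (T? (C A))))
  -- Membership proofs are irrelevant, so the decision yields `A∈C` itself and the listed pair is
  -- exactly `Z`.
  found rewrite dec-yes-irr (T? (C A)) T-irrelevant A∈C = MAny.just refl

x∈p─q⇒x∉q : ∀ {n} {x : Fin n} (p q : Subset n) → x ∈ p ─ q → x ∉ q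
x∈p─q⇒x∉q (outside ∷ _) (inside ∷ _) () here
x∈p─q⇒x∉q (inside  ∷ _) (inside ∷ _) () here
x∈p─q⇒x∉q (_ ∷ p)       (_ ∷ q)      (there x∈p─q) (there x∈q) = x∈p─q⇒x∉q p q x∈p─q x∈q

-- Weighted sums over subsets.

∑∈-nonNegative : ∀ {n} (w : Fin n → ℝ) → (∀ a → 0ℝ ≤ w a) → ∀ A → 0ℝ ≤ ∑∈ A w
∑∈-nonNegative w w≥0 []            = ≤-refl 0ℝ
∑∈-nonNegative w w≥0 (inside  ∷ A) =
  +-nonNegative (w zero) (∑∈ A (w ∘ suc)) (w≥0 zero) (∑∈-nonNegative (w ∘ suc) (w≥0 ∘ suc) A)
∑∈-nonNegative w w≥0 (outside ∷ A) = ∑∈-nonNegative (w ∘ suc) (w≥0 ∘ suc) A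

∑∈-mono : ∀ {n} (w : Fin n → ℝ) → (∀ a → 0ℝ ≤ w a) → ∀ A B → A ⊆ B → ∑∈ A w ≤ ∑∈ B w
∑∈-mono w w≥0 []            []            A⊆B = ≤-refl 0ℝ
∑∈-mono w w≥0 (outside ∷ A) (outside ∷ B) A⊆B =
  ∑∈-mono (w ∘ suc) (w≥0 ∘ suc) A B (drop-∷-⊆ A⊆B)
∑∈-mono w w≥0 (inside  ∷ A) (inside  ∷ B) A⊆B =
  +-monoʳ-≤ (w zero) (∑∈ A (w ∘ suc)) (∑∈ B (w ∘ suc))
    (∑∈-mono (w ∘ suc) (w≥0 ∘ suc) A B (drop-∷-⊆ A⊆B))
∑∈-mono w w≥0 (inside  ∷ A) (outside ∷ B) A⊆B with () ← A⊆B here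
∑∈-mono w w≥0 (outside ∷ A) (inside  ∷ B) A⊆B = begin
  ∑∈ A (w ∘ suc)           ≲⟨ ∑∈-mono (w ∘ suc) (w≥0 ∘ suc) A B (drop-∷-⊆ A⊆B) ⟩
  ∑∈ B (w ∘ suc)           ≲⟨ +-identityˡ-≥ (∑∈ B (w ∘ suc)) ⟩
  0ℝ + ∑∈ B (w ∘ suc)      ≲⟨ +-monoˡ-≤ 0ℝ (w zero) (∑∈ B (w ∘ suc)) (w≥0 zero) ⟩
  w zero + ∑∈ B (w ∘ suc)  ∎

-- A point of exactly one set is counted once on each side, a point of both sets twice. As an
-- equation in `ℚ` at each index `k`, it gives both inequalities of `μ-modular`.
∑∈-modular : ∀ {n} (w : Fin n → ℝ) A B k →
             seq (∑∈ (A ∪ B) w + ∑∈ (A ∩ B) w) k ≡ seq (∑∈ A w + ∑∈ B w) k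
∑∈-modular w []      []      k = refl
∑∈-modular w (s ∷ A) (t ∷ B) k = step s t
  where
  ∑ : Subset _ → ℚ
  ∑ C = seq (∑∈ C (w ∘ suc)) k
  w₀ : ℚ
  w₀ = seq (w zero) k
  ih : ∑ (A ∪ B) ℚ.+ ∑ (A ∩ B) ≡ ∑ A ℚ.+ ∑ B
  ih = ∑∈-modular (w ∘ suc) A B k
  right : ∀ p q r → q ℚ.+ (p ℚ.+ r) ≡ p ℚ.+ (q ℚ.+ r)
  right = solve 3 (λ p q r → q :+ (p :+ r) := p :+ (q :+ r)) refl
  left : (w₀ ℚ.+ ∑ (A ∪ B)) ℚ.+ ∑ (A ∩ B) ≡ w₀ ℚ.+ (∑ A ℚ.+ ∑ B)
  left = trans (ℚ.+-assoc w₀ (∑ (A ∪ B)) (∑ (A ∩ B))) (cong (w₀ ℚ.+_) ih)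
  step : ∀ s t → seq (∑∈ ((s ∷ A) ∪ (t ∷ B)) w + ∑∈ ((s ∷ A) ∩ (t ∷ B)) w) k
                 ≡ seq (∑∈ (s ∷ A) w + ∑∈ (t ∷ B) w) k
  step outside outside = ih
  step inside  outside = trans left (sym (ℚ.+-assoc w₀ (∑ A) (∑ B)))
  step outside inside  = trans left (sym (right w₀ (∑ A) (∑ B)))
  step inside  inside  =
    trans (+-interchange w₀ (∑ (A ∪ B)) w₀ (∑ (A ∩ B)))
      (trans (cong ((w₀ ℚ.+ w₀) ℚ.+_) ih) (sym (+-interchange w₀ (∑ A) w₀ (∑ B))))

-- Monotonicity and modularity of measures.

module Measure {n} (μ : Subset n → ℝ) (isMeasure : IsMeasure μ) where
  open IsMeasure isMeasure

  weight : Fin n → ℝ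
  weight a = μ ⁅ a ⁆

  μ-nonNegative : ∀ A → 0ℝ ≤ μ A
  μ-nonNegative A = begin
    0ℝ           ≲⟨ ∑∈-nonNegative weight nonNegative A ⟩
    ∑∈ A weight  ≲⟨ proj₂ (additive A) ⟩
    μ A          ∎

  μ-mono : ∀ A B → A ⊆ B → μ A ≤ μ B
  μ-mono A B A⊆B = begin
    μ A          ≲⟨ proj₁ (additive A) ⟩
    ∑∈ A weight  ≲⟨ ∑∈-mono weight nonNegative A B A⊆B ⟩
    ∑∈ B weight  ≲⟨ proj₂ (additive B) ⟩
    μ B          ∎

  μ-modular : ∀ A B → μ (A ∪ B) + μ (A ∩ B) ≃ μ A + μ B
  μ-modular A B = forth , back
    where
    ∑ : Subset n → ℝ
    ∑ C = ∑∈ C weight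
    +-additive : ∀ C D → μ C + μ D ≃ ∑ C + ∑ D
    +-additive C D =
        +-mono-≤ (μ C) (∑ C) (μ D) (∑ D) (proj₁ (additive C)) (proj₁ (additive D))
      , +-mono-≤ (∑ C) (μ C) (∑ D) (μ D) (proj₂ (additive C)) (proj₂ (additive D))
    forth : μ (A ∪ B) + μ (A ∩ B) ≤ μ A + μ B
    forth = begin
      μ (A ∪ B) + μ (A ∩ B)  ≲⟨ proj₁ (+-additive (A ∪ B) (A ∩ B)) ⟩
      ∑ (A ∪ B) + ∑ (A ∩ B)  ≲⟨ seq-≡⇒≤ (∑ (A ∪ B) + ∑ (A ∩ B)) (∑ A + ∑ B) (∑∈-modular weight A B) ⟩
      ∑ A + ∑ B              ≲⟨ proj₂ (+-additive A B) ⟩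
      μ A + μ B              ∎
    back : μ A + μ B ≤ μ (A ∪ B) + μ (A ∩ B)
    back = begin
      μ A + μ B              ≲⟨ proj₁ (+-additive A B) ⟩
      ∑ A + ∑ B              ≲⟨ seq-≡⇒≤ (∑ A + ∑ B) (∑ (A ∪ B) + ∑ (A ∩ B)) (sym ∘ ∑∈-modular weight A B) ⟩
      ∑ (A ∪ B) + ∑ (A ∩ B)  ≲⟨ proj₂ (+-additive (A ∪ B) (A ∩ B)) ⟩
      μ (A ∪ B) + μ (A ∩ B)  ∎

  μ-subadditive : ∀ A B → μ (A ∪ B) ≤ μ A + μ B
  μ-subadditive A B = begin
    μ (A ∪ B)              ≲⟨ +-identityʳ-≥ (μ (A ∪ B)) ⟩
    μ (A ∪ B) + 0ℝ         ≲⟨ +-monoʳ-≤ (μ (A ∪ B)) 0ℝ (μ (A ∩ B)) (μ-nonNegative (A ∩ B)) ⟩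
    μ (A ∪ B) + μ (A ∩ B)  ≲⟨ proj₁ (μ-modular A B) ⟩
    μ A + μ B              ∎

  -- Modularity passes from `P` and `Q` to their union and intersection, where the inclusions apply.
  -- Subadditivity splits off `μ V`, and modularity then returns to `X` and `Y`.
  μ-uncross : ∀ P Q X Y V → P ∪ Q ⊆ (X ∪ Y) ∪ V → P ∩ Q ⊆ X ∩ Y →
              μ P + μ Q ≤ μ V + (μ X + μ Y)
  μ-uncross P Q X Y V ∪⊆ ∩⊆ = begin
    μ P + μ Q
      ≲⟨ proj₂ (μ-modular P Q) ⟩
    μ (P ∪ Q) + μ (P ∩ Q)
      ≲⟨ +-mono-≤ (μ (P ∪ Q)) (μ ((X ∪ Y) ∪ V)) (μ (P ∩ Q)) (μ (X ∩ Y))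
           (μ-mono (P ∪ Q) ((X ∪ Y) ∪ V) ∪⊆) (μ-mono (P ∩ Q) (X ∩ Y) ∩⊆) ⟩
    μ ((X ∪ Y) ∪ V) + μ (X ∩ Y)
      ≲⟨ +-monoˡ-≤ (μ ((X ∪ Y) ∪ V)) (μ (X ∪ Y) + μ V) (μ (X ∩ Y)) (μ-subadditive (X ∪ Y) V) ⟩
    (μ (X ∪ Y) + μ V) + μ (X ∩ Y)
      ≲⟨ seq-≡⇒≤ ((μ (X ∪ Y) + μ V) + μ (X ∩ Y)) (μ V + (μ (X ∪ Y) + μ (X ∩ Y)))
           (λ k → rotate (seq (μ (X ∪ Y)) k) (seq (μ V) k) (seq (μ (X ∩ Y)) k)) ⟩
    μ V + (μ (X ∪ Y) + μ (X ∩ Y))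
      ≲⟨ +-monoʳ-≤ (μ V) (μ (X ∪ Y) + μ (X ∩ Y)) (μ X + μ Y) (proj₁ (μ-modular X Y)) ⟩
    μ V + (μ X + μ Y)
      ∎
    where
    rotate : ∀ a b c → (a ℚ.+ b) ℚ.+ c ≡ b ℚ.+ (a ℚ.+ c)
    rotate = solve 3 (λ a b c → (a :+ b) :+ c := b :+ (a :+ c)) refl

-- Set inclusions behind the uncrossing.

module _ {n} {Z₁ Z₂ J K : Subset n} (A B : Subset n) (Z₁⊆J : Z₁ ⊆ J) (Z₂⊆J : Z₂ ⊆ J) where

  -- A point outside `J` avoids both `Z₁` and `Z₂`, so it survives in the difference for whichever
  -- of `A`, `B` contains it. A point of `A ∩ B` outside `K` survives in one of the differences
  -- unless it lies in `Z₁ ∩ Z₂`, and then it belongs to the correction set.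
  ─-uncross-∪ : ((A ∪ B) ─ J) ∪ ((A ∩ B) ─ K) ⊆ ((A ─ Z₁) ∪ (B ─ Z₂)) ∪ ((Z₁ ∩ Z₂) ─ K)
  ─-uncross-∪ {x} x∈ with x∈p∪q⁻ ((A ∪ B) ─ J) ((A ∩ B) ─ K) x∈
  ... | inj₁ x∈A∪B─J = x∈p∪q⁺ (inj₁ (x∈p∪q⁺
    (Sum.map (λ x∈A → x∈p∧x∉q⇒x∈p─q x∈A (x∉J ∘ Z₁⊆J))
             (λ x∈B → x∈p∧x∉q⇒x∈p─q x∈B (x∉J ∘ Z₂⊆J))
             (x∈p∪q⁻ A B (p─q⊆p (A ∪ B) J x∈A∪B─J)))))
    where x∉J = x∈p─q⇒x∉q (A ∪ B) J x∈A∪B─J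
  ... | inj₂ x∈A∩B─K with x∈p∩q⁻ A B (p─q⊆p (A ∩ B) K x∈A∩B─K) | x ∈? Z₁ | x ∈? Z₂
  ... | x∈A , _   | no x∉Z₁  | _        = x∈p∪q⁺ (inj₁ (x∈p∪q⁺ (inj₁ (x∈p∧x∉q⇒x∈p─q x∈A x∉Z₁))))
  ... | _   , x∈B | yes _    | no x∉Z₂  = x∈p∪q⁺ (inj₁ (x∈p∪q⁺ (inj₂ (x∈p∧x∉q⇒x∈p─q x∈B x∉Z₂))))
  ... | _         | yes x∈Z₁ | yes x∈Z₂ =
    x∈p∪q⁺ (inj₂ (x∈p∧x∉q⇒x∈p─q (x∈p∩q⁺ (x∈Z₁ , x∈Z₂)) (x∈p─q⇒x∉q (A ∩ B) K x∈A∩B─K)))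

  -- The second set places the point in both `A` and `B`; the first keeps it outside `J`, hence
  -- outside `Z₁` and `Z₂`.
  ─-uncross-∩ : ((A ∪ B) ─ J) ∩ ((A ∩ B) ─ K) ⊆ (A ─ Z₁) ∩ (B ─ Z₂)
  ─-uncross-∩ x∈ with x∈p∩q⁻ ((A ∪ B) ─ J) ((A ∩ B) ─ K) x∈
  ... | x∈A∪B─J , x∈A∩B─K with x∈p∩q⁻ A B (p─q⊆p (A ∩ B) K x∈A∩B─K)
  ... | x∈A , x∈B = x∈p∩q⁺
    ( x∈p∧x∉q⇒x∈p─q x∈A (x∉J ∘ Z₁⊆J)
    , x∈p∧x∉q⇒x∈p─q x∈B (x∉J ∘ Z₂⊆J) )
    where x∉J = x∈p─q⇒x∉q (A ∪ B) J x∈A∪B─J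

-- The convolution as a greatest lower bound.

module Convolution {n} (L : RankedLattice n) (μ : Subset n → ℝ) where
  open RankedLattice L

  r : Subset n → ℝ
  r = convolution L μ

  -- Agrees by unfolding with the function local to `convolution`, with the set `A` made an explicit
  -- argument.
  value : Subset n → Member ℒ → ℝ
  value A Z = rank Z + μ (A ─ proj₁ Z)

  r-lower : ∀ A Z → r A ≤ value A Z
  r-lower A Z = foldr-⊓-lower (value A) (value A nonEmpty) (∈-members ℒ Z)

  r-elim : ∀ (P : ℝ → Set) A → (∀ x y → P x → P y → P (x ⊓ y)) → (∀ Z → P (value A Z)) → P (r A)
  r-elim P A P-⊓ P-value =
    -- The fold starts at the value of a member, so `P-value` covers the base case too.
    foldr-⊓-elim P (value A) P-⊓ (P-value nonEmpty) P-value (members ℒ)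

  r-greatest : ∀ A z → (∀ Z → z ≤ value A Z) → z ≤ r A
  r-greatest A z = r-elim (z ≤_) A (λ x y → ⊓-greatest x y z)

  r-greatest-+ : ∀ A c z → (∀ Z → z ≤ value A Z + c) → z ≤ r A + c
  r-greatest-+ A c z = r-elim (λ x → z ≤ x + c) A (λ x y → ⊓-greatest-+ c x y z)

  -- The minima are removed one at a time: over `Z₁` with `r B` as the fixed summand, then over `Z₂`
  -- with `value A Z₁` fixed. Commutativity brings the second minimum to the left, where
  -- `r-greatest-+` acts.
  r+r-greatest : ∀ A B z → (∀ Z₁ Z₂ → z ≤ value A Z₁ + value B Z₂) → z ≤ r A + r B
  r+r-greatest A B z z≤ = r-greatest-+ A (r B) z λ Z₁ → begin
    z                  ≲⟨ r-greatest-+ B (value A Z₁) z (λ Z₂ → begin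
      z                          ≲⟨ z≤ Z₁ Z₂ ⟩
      value A Z₁ + value B Z₂    ≲⟨ +-comm-≤ (value A Z₁) (value B Z₂) ⟩
      value B Z₂ + value A Z₁    ∎) ⟩
    r B + value A Z₁   ≲⟨ +-comm-≤ (r B) (value A Z₁) ⟩
    value A Z₁ + r B   ∎

-- Polymatroid axioms for the convolution.

theorem7 : (n : ℕ) (L : RankedLattice n) (μ : Subset n → ℝ) → IsMeasure μ →
    let open RankedLattice L in
    (∀ (Z₁ Z₂ : Member ℒ) →
    rank (Z₁ ∨ Z₂) + rank (Z₁ ∧ Z₂) + μ ((proj₁ Z₁ ∩ proj₁ Z₂) ─ proj₁ (Z₁ ∧ Z₂))
    ≤ rank Z₁ + rank Z₂) →
    IsPolymatroid (convolution L μ)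
theorem7 n L μ isMeasure rank-submodular = record
  { nonNegative = λ A → r-greatest A 0ℝ λ Z →
      +-nonNegative (rank Z) (μ (A ─ proj₁ Z)) (rank≥0 Z) (μ-nonNegative (A ─ proj₁ Z))
  -- Each candidate `Z` for `B` also serves for `A`, at no greater value.
  ; monotone = λ A B A⊆B → r-greatest B (r A) λ Z → begin
      r A        ≲⟨ r-lower A Z ⟩
      value A Z  ≲⟨ +-monoʳ-≤ (rank Z) (μ (A ─ proj₁ Z)) (μ (B ─ proj₁ Z))
                      (μ-mono (A ─ proj₁ Z) (B ─ proj₁ Z) (─-monoˡ A B (proj₁ Z) A⊆B)) ⟩
      value B Z  ∎
  ; submodular = λ A B → r+r-greatest A B (r (A ∪ B) + r (A ∩ B)) (bound A B)
  }
  where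
  open RankedLattice L
  open IsLattice isLattice using (x≤x∨y; y≤x∨y)
  open Convolution L μ
  open Measure μ isMeasure

  ─-monoˡ : ∀ A B C → A ⊆ B → A ─ C ⊆ B ─ C
  ─-monoˡ A B C A⊆B x∈A─C = x∈p∧x∉q⇒x∈p─q (A⊆B (p─q⊆p A C x∈A─C)) (x∈p─q⇒x∉q A C x∈A─C)

  bound : ∀ A B Z₁ Z₂ → r (A ∪ B) + r (A ∩ B) ≤ value A Z₁ + value B Z₂
  bound A B Z₁ Z₂ = begin
    r (A ∪ B) + r (A ∩ B)
      ≲⟨ +-mono-≤ (r (A ∪ B)) (λJ + μ P) (r (A ∩ B)) (λK + μ Q)
           (r-lower (A ∪ B) J) (r-lower (A ∩ B) K) ⟩
    (λJ + μ P) + (λK + μ Q)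
      ≲⟨ +-interchange-≤ λJ (μ P) λK (μ Q) ⟩
    (λJ + λK) + (μ P + μ Q)
      ≲⟨ +-monoʳ-≤ (λJ + λK) (μ P + μ Q) (μ V + (μ X + μ Y))
           (μ-uncross P Q X Y V (─-uncross-∪ A B Z₁⊆J Z₂⊆J) (─-uncross-∩ A B Z₁⊆J Z₂⊆J)) ⟩
    (λJ + λK) + (μ V + (μ X + μ Y))
      -- Reassociating joins `μ V` to the two ranks, which forms the left side of `rank-submodular`.
      ≲⟨ seq-≡⇒≤ ((λJ + λK) + (μ V + (μ X + μ Y))) ((λJ + λK + μ V) + (μ X + μ Y))
           (λ k → sym (ℚ.+-assoc (seq (λJ + λK) k) (seq (μ V) k) (seq (μ X + μ Y) k))) ⟩
    (λJ + λK + μ V) + (μ X + μ Y)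
      ≲⟨ +-monoˡ-≤ (λJ + λK + μ V) (rank Z₁ + rank Z₂) (μ X + μ Y) (rank-submodular Z₁ Z₂) ⟩
    (rank Z₁ + rank Z₂) + (μ X + μ Y)
      ≲⟨ +-interchange-≤ (rank Z₁) (rank Z₂) (μ X) (μ Y) ⟩
    (rank Z₁ + μ X) + (rank Z₂ + μ Y)
      ∎
    where
    J K : Member ℒ
    J = Z₁ ∨ Z₂
    K = Z₁ ∧ Z₂
    λJ λK : ℝ
    λJ = rank J
    λK = rank K
    P Q X Y V : Subset n
    P = (A ∪ B) ─ proj₁ J
    Q = (A ∩ B) ─ proj₁ K
    X = A ─ proj₁ Z₁
    Y = B ─ proj₁ Z₂
    V = (proj₁ Z₁ ∩ proj₁ Z₂) ─ proj₁ K
    Z₁⊆J : proj₁ Z₁ ⊆ proj₁ J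
    Z₁⊆J = x≤x∨y Z₁ Z₂
    Z₂⊆J : proj₁ Z₂ ⊆ proj₁ J
    Z₂⊆J = y≤x∨y Z₁ Z₂
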